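{- For all graphs $G$ and $H$, $$\operatorname{pw}(G\boxtimes H)\geq (\operatorname{pw}(G)+1)(\operatorname{pw}(H)+1)-1.$$
   Context: All graphs are simple, finite and undirected. A path-decomposition of a graph $G$ is a pair $(T,\beta)$ consisting of a path $T$ and a function $\beta:V(T)\to 2^{V(G)}$ such that (i) for every $v\in V(G)$, the set $\{t\in V(T): v\in\beta(t)\}$ is non-empty and induces a connected subgraph of $T$; and (ii) for every edge $uv\in E(G)$ there is $t\in V(T)$ with $\{u,v\}\subseteq\beta(t)$. Its width is $\max_{t\in V(T)}|\beta(t)|-1$. The pathwidth $\operatorname{pw}(G)$ is the minimum width of a path-decomposition of $G$. The strong product $G\boxtimes H$ is the graph with vertex set $V(G)\times V(H)$, where $(g_1,h_1)(g_2,h_2)$ is an edge if and only if $g_1=g_2$ and $h_1h_2\in E(H)$; or $g_1g_2\in E(G)$ and $h_1=h_2$; or $g_1g_2\in E(G)$ and $h_1h_2\in E(H)$. -}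

module Defs where

open import Data.Empty using (⊥-elim)
open import Data.Fin as Fin using (Fin; zero; suc; toℕ; fromℕ<; finToFun; funToFin)
open import Data.Fin.Properties as Fin
  using (*↔×; any?; toℕ<n; toℕ-fromℕ<; toℕ-injective; finToFun-funToFin)
open import Data.Fin.Subset as Subset using (Subset; inside; ∣_∣)
open import Data.Fin.Subset.Properties using (p⊆q⇒∣p∣≤∣q∣; p⊂q⇒∣p∣<∣q∣; ∣p∣≤n; ∣⊥∣≡0; _∈?_)
open import Data.Integer as ℤ using (ℤ; +_)
open import Data.Integer.Properties as ℤ using ()
open import Data.List using (List; tabulate)
open import Data.List.Extrema.Nat using (max; argmin; xs≤max; max≤v⁺; f[argmin]≤v⁺)
import Data.List.Relation.Unary.All.Properties as All
import Data.List.Relation.Unary.Any.Properties as Any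
open import Data.Nat as ℕ using (ℕ; zero; suc; _*_; _≤_; _<_; z≤n; s≤s)
open import Data.Nat.Properties as ℕ using (≤-refl; ≤-trans; ≤-reflexive; <⇒≱)
open import Data.Product using (∃; _×_; _,_; proj₁; proj₂; map₂)
open import Data.Product.Function.NonDependent.Propositional using (_×-↔_)
open import Data.Sum using (_⊎_; inj₁; inj₂; swap)
import Data.Vec as Vec
open import Data.Vec.Properties using (lookup∘tabulate; lookup⇒[]=; []=⇒lookup)
open import Function using (_↔_; Inverse)
open import Function.Construct.Composition using (_↔-∘_)
open import Function.Construct.Identity using (↔-id)
open import Function.Construct.Symmetry using (↔-sym)
open import Function.Properties.Inverse using (↔⇒↣)
open import Level using (0ℓ)
open import Relation.Binary using (Rel; Decidable; DecidableEquality; Symmetric; Irreflexive)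
open import Relation.Binary.Construct.Closure.ReflexiveTransitive as Star using (Star; ε; _◅_)
open import Relation.Binary.PropositionalEquality
open import Relation.Nullary using (Dec; yes; no; does)
open import Relation.Nullary.Decidable
  using (_×-dec_; _⊎-dec_; via-injection; dec-true)
open import Relation.Unary using (Pred) renaming (Decidable to Decidable₁)

record Graph : Set₁ where
  infix 4 _~_ _~?_
  field
    V      : Set
    order  : ℕ
    finite : V ↔ Fin order
    _~_    : Rel V 0ℓ
    _~?_   : Decidable _~_
    ~-sym  : Symmetric _~_
    irrefl : Irreflexive _≡_ _~_

  open Inverse finite public using () renaming (to to index; from to vertex)

  _≟_ : DecidableEquality V
  _≟_ = via-injection (↔⇒↣ finite) Fin._≟_

  -- Sets of vertices, represented by their sets of indices.
  VertexSet : Set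
  VertexSet = Subset order

  infix 4 _∈_
  _∈_ : V → VertexSet → Set
  v ∈ S = index v Subset.∈ S

open Graph using (V; VertexSet)

module _ (G H : Graph) where
  private
    module G = Graph G
    module H = Graph H

  infixr 7 _⊠_
  _⊠_ : Graph
  _⊠_ = record
    { V      = V G × V H
    ; order  = G.order * H.order
    ; finite = ↔-sym *↔× ↔-∘ (G.finite ×-↔ H.finite)
    ; _~_    = λ (g₁ , h₁) (g₂ , h₂) →
        (g₁ ≡ g₂ × h₁ H.~ h₂) ⊎ (g₁ G.~ g₂ × h₁ ≡ h₂) ⊎ (g₁ G.~ g₂ × h₁ H.~ h₂)
    ; _~?_   = λ (g₁ , h₁) (g₂ , h₂) →
        ((g₁ G.≟ g₂) ×-dec (h₁ H.~? h₂)) ⊎-dec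
        ((g₁ G.~? g₂) ×-dec (h₁ H.≟ h₂)) ⊎-dec
        ((g₁ G.~? g₂) ×-dec (h₁ H.~? h₂))
    ; ~-sym  = λ where
        (inj₁ (p , q))        → inj₁ (sym p , H.~-sym q)
        (inj₂ (inj₁ (p , q))) → inj₂ (inj₁ (G.~-sym p , sym q))
        (inj₂ (inj₂ (p , q))) → inj₂ (inj₂ (G.~-sym p , H.~-sym q))
    ; irrefl = λ where
        refl (inj₁ (_ , q))        → H.irrefl refl q
        refl (inj₂ (inj₁ (p , _))) → G.irrefl refl p
        refl (inj₂ (inj₂ (p , _))) → G.irrefl refl p
    }

-- The path with ℓ edges, on the ℓ + 1 vertices 0, 1, …, ℓ.
path : ℕ → Graph
path ℓ = record
  { V      = Fin (suc ℓ)
  ; order  = suc ℓ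
  ; finite = ↔-id _
  ; _~_    = λ s t → toℕ t ≡ suc (toℕ s) ⊎ toℕ s ≡ suc (toℕ t)
  ; _~?_   = λ s t → (toℕ t ℕ.≟ suc (toℕ s)) ⊎-dec (toℕ s ℕ.≟ suc (toℕ t))
  ; ~-sym  = swap
  ; irrefl = λ where
      refl (inj₁ p) → ℕ.1+n≢n (sym p)
      refl (inj₂ p) → ℕ.1+n≢n (sym p)
  }

InducesConnected : (G : Graph) → Pred (V G) 0ℓ → Set
InducesConnected G P = ∀ {s t} → P s → P t → Star (λ x y → x ~ y × P x × P y) s t
  where open Graph G

record PathDecomposition (G : Graph) : Set where
  open Graph G using (_~_; _∈_)
  field
    ℓ : ℕ
  T : Graph
  T = path ℓ
  field
    β         : V T → VertexSet G
    nonempty  : ∀ v → ∃ λ t → v ∈ β t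
    connected : ∀ v → InducesConnected T (λ t → v ∈ β t)
    edges     : ∀ {u v} → u ~ v → ∃ λ t → u ∈ β t × v ∈ β t

  maxBag : ℕ
  maxBag = max 0 (tabulate λ t → ∣ β t ∣)

  -- Integer-valued: the width is -1 when all bags are empty.
  width : ℤ
  width = + maxBag ℤ.- + 1

open PathDecomposition using (maxBag; width)

IsPathwidth : Graph → ℤ → Set
IsPathwidth G k =
  (∃ λ (D : PathDecomposition G) → width D ≡ k) ×
  (∀ (D : PathDecomposition G) → k ℤ.≤ width D)

-- The minimum exists: every decomposition is dominated by one that is
-- determined by a map ranking the vertices in Fin (suc order), and there are
-- finitely many such maps.

module Existence where

  ⟨_⟩ : ∀ {n} {P : Pred (Fin n) 0ℓ} → Decidable₁ P → Subset n
  ⟨ P? ⟩ = Vec.tabulate (λ i → does (P? i))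

  ⟨⟩⁺ : ∀ {n} {P : Pred (Fin n) 0ℓ} (P? : Decidable₁ P) {i} → P i → i Subset.∈ ⟨ P? ⟩
  ⟨⟩⁺ P? {i} p = lookup⇒[]= i _ (trans (lookup∘tabulate _ i) (dec-true (P? i) p))

  ⟨⟩⁻ : ∀ {n} {P : Pred (Fin n) 0ℓ} (P? : Decidable₁ P) {i} → i Subset.∈ ⟨ P? ⟩ → P i
  ⟨⟩⁻ P? {i} i∈ with P? i | trans (sym (lookup∘tabulate _ i)) ([]=⇒lookup i∈)
  ... | yes p | _  = p
  ... | no  _ | ()

  least : ∀ {n} {P : Pred (Fin n) 0ℓ} → Decidable₁ P → ∃ P →
          ∃ λ t → P t × (∀ {s} → P s → t Fin.≤ s)
  least {suc n} P? (t , p) with P? zero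
  ... | yes p₀ = zero , p₀ , λ _ → z≤n
  least {suc n} P? (zero  , p) | no ¬p₀ = ⊥-elim (¬p₀ p)
  least {suc n} {P} P? (suc t , p) | no ¬p₀ with least (λ i → P? (suc i)) (t , p)
  ... | t′ , p′ , min = suc t′ , p′ , bound
    where
    bound : ∀ {s} → P s → suc t′ Fin.≤ s
    bound {zero}  q = ⊥-elim (¬p₀ q)
    bound {suc _} q = s≤s (min q)

  greatest : ∀ {n} {P : Pred (Fin n) 0ℓ} → Decidable₁ P → ∃ P →
             ∃ λ t → P t × (∀ {s} → P s → s Fin.≤ t)
  greatest {suc n} {P} P? e with any? (λ i → P? (suc i))
  greatest {suc n} {P} P? e | yes e′ with greatest (λ i → P? (suc i)) e′
  ... | t , p , max = suc t , p , bound
    where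
    bound : ∀ {s} → P s → s Fin.≤ suc t
    bound {zero}  _ = z≤n
    bound {suc _} q = s≤s (max q)
  greatest {suc n} {P} P? (zero  , p) | no ¬e = zero , p , bound
    where
    bound : ∀ {s} → P s → s Fin.≤ zero {n}
    bound {zero}  _ = z≤n
    bound {suc s} q = ⊥-elim (¬e (s , q))
  greatest {suc n} P? (suc t , p) | no ¬e = ⊥-elim (¬e (t , p))

  Convex : ∀ {n} → Pred (Fin n) 0ℓ → Set
  Convex P = ∀ {s m t} → P s → P t → s Fin.≤ m → m Fin.≤ t → P m

  walk⇒convex : ∀ {ℓ} {P : Pred (Fin (suc ℓ)) 0ℓ} {s m t} →
    Star (λ x y → Graph._~_ (path ℓ) x y × P x × P y) s t →
    P s → s Fin.≤ m → m Fin.≤ t → P m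
  walk⇒convex {P = P} ε p s≤m m≤t = subst P (toℕ-injective (ℕ.≤-antisym s≤m m≤t)) p
  walk⇒convex {P = P} {m = m} (_◅_ {j = s′} (adj , p , p′) w) _ s≤m m≤t with s′ Fin.≤? m
  ... | yes s′≤m = walk⇒convex w p′ s′≤m m≤t
  ... | no  s′≰m with adj
  ...   | inj₁ e = subst P (toℕ-injective (ℕ.≤-antisym s≤m
                     (ℕ.≤-pred (≤-trans (ℕ.≰⇒> s′≰m) (≤-reflexive e))))) p
  ...   | inj₂ e = ⊥-elim (s′≰m (≤-trans (≤-trans (ℕ.n≤1+n _) (≤-reflexive (sym e))) s≤m))

  connected⇒convex : ∀ {ℓ} {P : Pred (Fin (suc ℓ)) 0ℓ} →
                     InducesConnected (path ℓ) P → Convex P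
  connected⇒convex c p q = walk⇒convex (c p q) p

  convex⇒walk : ∀ {ℓ} {P : Pred (Fin (suc ℓ)) 0ℓ} → Convex P →
    ∀ d {s t} → P s → P t → toℕ t ≡ toℕ s ℕ.+ d →
    Star (λ x y → Graph._~_ (path ℓ) x y × P x × P y) s t
  convex⇒walk conv zero p q e =
    subst (Star _ _) (toℕ-injective (trans (sym (ℕ.+-identityʳ _)) (sym e))) ε
  convex⇒walk {ℓ} {P} conv (suc d) {s} {t} p q e =
    (inj₁ s′≡ , p , p′) ◅ convex⇒walk conv d p′ q e′
    where
    s<t : toℕ s < toℕ t
    s<t = ≤-trans (s≤s (ℕ.m≤m+n _ d)) (≤-reflexive (sym (trans e (ℕ.+-suc _ d))))
    s′ : Fin (suc ℓ)
    s′ = fromℕ< (ℕ.≤-<-trans s<t (toℕ<n t))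
    s′≡ : toℕ s′ ≡ suc (toℕ s)
    s′≡ = toℕ-fromℕ< (ℕ.≤-<-trans s<t (toℕ<n t))
    p′ : P s′
    p′ = conv {m = s′} p q (≤-trans (ℕ.n≤1+n _) (≤-reflexive (sym s′≡)))
                  (≤-trans (≤-reflexive s′≡) s<t)
    e′ : toℕ t ≡ toℕ s′ ℕ.+ d
    e′ = trans e (trans (ℕ.+-suc _ d) (cong (ℕ._+ d) (sym s′≡)))

  convex⇒connected : ∀ {ℓ} {P : Pred (Fin (suc ℓ)) 0ℓ} →
                     Convex P → InducesConnected (path ℓ) P
  convex⇒connected conv {s} {t} p q with ℕ.≤-total (toℕ s) (toℕ t)
  ... | inj₁ s≤t = convex⇒walk conv _ p q (sym (ℕ.m+[n∸m]≡n s≤t))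
  ... | inj₂ t≤s = Star.reverse (λ (a , x , y) → swap a , y , x)
                     (convex⇒walk conv (toℕ s ℕ.∸ toℕ t) q p (sym (ℕ.m+[n∸m]≡n t≤s)))

  module _ (G : Graph) where
    open Graph G using (order; _~_; _~?_; ~-sym; index; vertex; finite; _∈_)

    vertex∘index : ∀ v → vertex (index v) ≡ v
    vertex∘index = Inverse.strictlyInverseʳ finite

    index∘vertex : ∀ i → index (vertex i) ≡ i
    index∘vertex = Inverse.strictlyInverseˡ finite

    -- With l as left endpoints, i must stay in the bags up to the left
    -- endpoint of its last neighbour.
    Alive : ∀ {m} → (Fin order → Fin m) → Fin m → Pred (Fin order) 0ℓ
    Alive l t i = l i Fin.≤ t ×
      ∃ λ u → (i ≡ u ⊎ vertex i ~ vertex u) × t Fin.≤ l u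

    alive? : ∀ {m} (l : Fin order → Fin m) t → Decidable₁ (Alive l t)
    alive? l t i = (l i Fin.≤? t) ×-dec
      any? (λ u → ((i Fin.≟ u) ⊎-dec (vertex i ~? vertex u)) ×-dec (t Fin.≤? l u))

    layout : ∀ {m} → (Fin order → Fin (suc m)) → PathDecomposition G
    layout {m} l = record
      { ℓ         = m
      ; β         = λ t → ⟨ alive? l t ⟩
      ; nonempty  = λ v → l (index v) , ⟨⟩⁺ (alive? l _) (alive-left (index v))
      ; connected = λ v → convex⇒connected λ {s} {m′} {t} p q s≤m m≤t →
          ⟨⟩⁺ (alive? l m′) (alive-convex {index v} {s} {m′} {t} (⟨⟩⁻ (alive? l s) p) (⟨⟩⁻ (alive? l t) q) s≤m m≤t)
      ; edges     = λ {u} {v} u~v → alive-edge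
          (subst₂ _~_ (sym (vertex∘index u)) (sym (vertex∘index v)) u~v)
      }
      where
      alive-left : ∀ i → Alive l (l i) i
      alive-left i = ≤-refl , i , inj₁ refl , ≤-refl

      alive-convex : ∀ {i} → Convex (λ t → Alive l t i)
      alive-convex (l≤s , _) (_ , u , iu , t≤u) s≤m m≤t =
        ≤-trans l≤s s≤m , u , iu , ≤-trans m≤t t≤u

      alive-edge : ∀ {i j} → vertex i ~ vertex j →
        ∃ λ t → i Subset.∈ ⟨ alive? l t ⟩ × j Subset.∈ ⟨ alive? l t ⟩
      alive-edge {i} {j} a with ℕ.≤-total (toℕ (l i)) (toℕ (l j))
      ... | inj₁ i≤j = l j , ⟨⟩⁺ (alive? l _) (i≤j , j , inj₂ a , ≤-refl)
                           , ⟨⟩⁺ (alive? l _) (alive-left j)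
      ... | inj₂ j≤i = l i , ⟨⟩⁺ (alive? l _) (alive-left i)
                           , ⟨⟩⁺ (alive? l _) (j≤i , i , inj₂ (~-sym a) , ≤-refl)

    module _ (D : PathDecomposition G) where
      open PathDecomposition D using (ℓ; β; nonempty; connected; edges)

      ∈β? : ∀ (i : Fin order) t → Dec (i Subset.∈ β t)
      ∈β? i t = i ∈? β t

      convex : ∀ i → Convex (λ t → i Subset.∈ β t)
      convex i = subst (λ j → Convex (λ t → j Subset.∈ β t)) (index∘vertex i)
        (connected⇒convex (connected (vertex i)))

      leftmost : ∀ i → ∃ λ t → i Subset.∈ β t × (∀ {s} → i Subset.∈ β s → t Fin.≤ s)
      leftmost i = least (∈β? i)
        (map₂ (subst (Subset._∈ _) (index∘vertex i)) (nonempty (vertex i)))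

      left : Fin order → Fin (suc ℓ)
      left i = proj₁ (leftmost i)

      alive⇒∈ : ∀ {i t} → Alive left t i → i Subset.∈ β t
      alive⇒∈ {i} (l≤t , _ , inj₁ refl , t≤u) =
        convex i (proj₁ (proj₂ (leftmost i))) (proj₁ (proj₂ (leftmost i))) l≤t t≤u
      alive⇒∈ {i} (l≤t , u , inj₂ a , t≤u) with edges a
      ... | s , i∈ , u∈ = convex i (proj₁ (proj₂ (leftmost i)))
        (subst (Subset._∈ _) (index∘vertex i) i∈) l≤t
        (≤-trans t≤u (proj₂ (proj₂ (leftmost u)) (subst (Subset._∈ _) (index∘vertex u) u∈)))

      before : Fin (suc ℓ) → Subset order
      before t = ⟨ (λ j → left j Fin.<? t) ⟩

      before-mono : ∀ {s t} → s Fin.≤ t → before s Subset.⊆ before t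
      before-mono s≤t j∈ =
        ⟨⟩⁺ (λ j → left j Fin.<? _) (ℕ.<-≤-trans (⟨⟩⁻ (λ j → left j Fin.<? _) j∈) s≤t)

      ∣before-zero∣ : ∣ before zero ∣ ≤ 0
      ∣before-zero∣ = ≤-trans
        (p⊆q⇒∣p∣≤∣q∣ {q = Subset.⊥} λ {i} j∈ →
          ⊥-elim (ℕ.n≮0 {toℕ (left i)} (⟨⟩⁻ (λ j → left j Fin.<? zero {ℓ}) {i} j∈)))
        (≤-reflexive (∣⊥∣≡0 order))

      rank : Fin order → ℕ
      rank i = ∣ before (left i) ∣

      rank-< : ∀ {t} i → left i Fin.< t → rank i < ∣ before t ∣
      rank-< i i<t = p⊂q⇒∣p∣<∣q∣
        ( before-mono (ℕ.<⇒≤ i<t)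
        , i , ⟨⟩⁺ (λ j → left j Fin.<? _) i<t
        , λ i∈ → ℕ.<-irrefl refl (⟨⟩⁻ (λ j → left j Fin.<? left i) i∈))

      layout-bag : ∀ {m} (l : Fin order → Fin (suc m)) → (∀ i → toℕ (l i) ≡ rank i) →
        ∀ t → ∃ λ s → ⟨ alive? l t ⟩ Subset.⊆ β s
      layout-bag l l≡ t
        with greatest (λ s → ∣ before s ∣ ℕ.≤? toℕ t) (zero , ≤-trans ∣before-zero∣ z≤n)
      ... | s , Fs≤t , max = s , λ {i} i∈ → alive⇒∈ (go (⟨⟩⁻ (alive? l t) i∈))
        where
        go : ∀ {i} → Alive l t i → Alive left s i
        go {i} (li≤t , u , iu , t≤lu) =
          max (subst (_≤ toℕ t) (l≡ i) li≤t) , u , iu ,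
          ℕ.≮⇒≥ (λ u<s → <⇒≱ (rank-< u u<s)
            (≤-trans Fs≤t (subst (toℕ t ≤_) (l≡ u) t≤lu)))

      layout-≤ : ∀ {m} (l : Fin order → Fin (suc m)) → (∀ i → toℕ (l i) ≡ rank i) →
        maxBag (layout l) ≤ maxBag D
      layout-≤ l l≡ = max≤v⁺ z≤n (All.tabulate⁺ λ t →
        let s , sub = layout-bag l l≡ t in
        ≤-trans (p⊆q⇒∣p∣≤∣q∣ (λ {i} → sub {i})) (All.tabulate⁻ {f = λ s → ∣ β s ∣} (xs≤max 0 (tabulate λ s′ → ∣ β s′ ∣)) s))

    layouts : List (Fin order → Fin (suc order))
    layouts = tabulate (finToFun {suc order} {order})

    best : Fin order → Fin (suc order)
    best = argmin (λ l → maxBag (layout l)) (λ _ → zero) layouts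

    best-≤ : ∀ D → maxBag (layout best) ≤ maxBag D
    best-≤ D = f[argmin]≤v⁺ {f = λ l → maxBag (layout l)} (λ _ → zero) layouts
      (inj₂ (Any.tabulate⁺ (funToFin r) (layout-≤ D _ λ i →
        trans (cong toℕ (finToFun-funToFin r i)) (toℕ-fromℕ< _))))
      where
      r : Fin order → Fin (suc order)
      r i = fromℕ< (s≤s (∣p∣≤n (before D (left D i))))

open Existence using (layout; best; best-≤)

abstract
  pathwidth : ∀ G → ∃ (IsPathwidth G)
  pathwidth G =
    width (layout G (best G)) ,
    (layout G (best G) , refl) ,
    λ D → ℤ.+-monoˡ-≤ (ℤ.- + 1) (ℤ.+≤+ (best-≤ G D))

-- Since `pathwidth` is abstract, `pw` is known only through `pw-isPathwidth`.
pw : Graph → ℤ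
pw G = proj₁ (pathwidth G)

pw-isPathwidth : ∀ G → IsPathwidth G (pw G)
pw-isPathwidth G = proj₂ (pathwidth G)

-- Let every path-decomposition of H have a bag of size more than q. Call a
-- vertex set of H small if it lies in a set that a sweep with bags of size at
-- most q can process first; by submodularity of the boundary, a small set stays
-- small when it is extended across one bag of size at most q. In a decomposition
-- of G ⊠ H, consider for each vertex g of G the part of the fibre over g seen up
-- to time t. Let g be active from the first time τ g at which this part is not
-- small, for as long as the bag meets the fibre in more than q vertices. Whatever
-- has left the fibre over g has met its neighbours in the fibre over any g′ ~ g, so
-- if g stopped being active by time τ g′ ≥ τ g, then smallness for g′ before τ g′
-- would give smallness for g after τ g. Hence the sets of active vertices form a
-- path-decomposition of G, and each active vertex accounts for q + 1 elements of
-- the bag above.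
module Submission where

open import Defs
open import Data.Bool using (true; false)
open import Data.Empty using (⊥-elim)
open import Data.Fin as Fin using (Fin; zero; suc; toℕ; fromℕ; fromℕ<; inject₁; combine)
open import Data.Fin.Properties
  using (any?; all?; toℕ<n; toℕ-fromℕ; toℕ-fromℕ<; toℕ-inject₁)
open import Data.Fin.Subset using (Subset; ∣_∣; _∈_; _∉_; _⊆_; _∪_; _∩_; ∁; ⊥; ⊤)
open import Data.Fin.Subset.Properties
open import Data.List using (tabulate)
open import Data.List.Extrema.Nat using (max≤v⁺; xs≤max; argmax-all)
import Data.List.Relation.Unary.All.Properties as All
open import Data.Integer as ℤ using (+_; _+_; _-_; -_; _*_; _≥_)
import Data.Integer.Properties as ℤ
open import Data.Nat as ℕ using (ℕ; zero; suc; z≤n; s≤s; _≤_; _<_)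
open import Data.Nat.Properties as ℕ using (≤-refl; ≤-trans; ≤-reflexive)
open import Data.Product using (∃; _×_; _,_; proj₁; proj₂)
open import Data.Sum using (_⊎_; inj₁; inj₂; [_,_]′)
open import Data.Vec using ([]; _∷_; _++_; splitAt; here; there)
open import Data.Vec.Properties using (lookup-++ˡ; lookup-++ʳ; lookup⇒[]=; []=⇒lookup)
open import Function using (_∘_; id)
open import Relation.Binary.PropositionalEquality
open import Relation.Nullary using (¬_; Dec; yes; no)
open import Relation.Nullary.Decidable using (_×-dec_; _→-dec_; ¬?; decidable-stable)
open import Relation.Unary using (Decidable)

open Existence
open PathDecomposition using (maxBag)

-- Cardinalities and searches for finite subsets.

∣p∪q∣+∣p∩q∣ : ∀ {n} (p q : Subset n) → ∣ p ∪ q ∣ ℕ.+ ∣ p ∩ q ∣ ≡ ∣ p ∣ ℕ.+ ∣ q ∣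
∣p∪q∣+∣p∩q∣ []          []          = refl
∣p∪q∣+∣p∩q∣ (false ∷ p) (false ∷ q) = ∣p∪q∣+∣p∩q∣ p q
∣p∪q∣+∣p∩q∣ (false ∷ p) (true  ∷ q) =
  trans (cong suc (∣p∪q∣+∣p∩q∣ p q)) (sym (ℕ.+-suc _ _))
∣p∪q∣+∣p∩q∣ (true  ∷ p) (false ∷ q) = cong suc (∣p∪q∣+∣p∩q∣ p q)
∣p∪q∣+∣p∩q∣ (true  ∷ p) (true  ∷ q) = cong suc
  (trans (ℕ.+-suc _ _) (trans (cong suc (∣p∪q∣+∣p∩q∣ p q)) (sym (ℕ.+-suc _ _))))

∣p∪q∣≤∣p∣+∣q∣ : ∀ {n} (p q : Subset n) → ∣ p ∪ q ∣ ≤ ∣ p ∣ ℕ.+ ∣ q ∣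
∣p∪q∣≤∣p∣+∣q∣ p q = ≤-trans (ℕ.m≤m+n _ _) (≤-reflexive (∣p∪q∣+∣p∩q∣ p q))

∣p∣+∣q∣≤∣r∣ : ∀ {n} {p q r : Subset n} → (∀ {x} → x ∈ p → x ∉ q) → p ⊆ r → q ⊆ r →
              ∣ p ∣ ℕ.+ ∣ q ∣ ≤ ∣ r ∣
∣p∣+∣q∣≤∣r∣ {n} {p} {q} {r} disjoint p⊆r q⊆r = begin
  ∣ p ∣ ℕ.+ ∣ q ∣          ≡⟨ ∣p∪q∣+∣p∩q∣ p q ⟨
  ∣ p ∪ q ∣ ℕ.+ ∣ p ∩ q ∣  ≤⟨ ℕ.+-mono-≤ (p⊆q⇒∣p∣≤∣q∣ ∪⊆r) (p⊆q⇒∣p∣≤∣q∣ ∩⊆⊥) ⟩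
  ∣ r ∣ ℕ.+ ∣ ⊥ {n} ∣      ≡⟨ cong (∣ r ∣ ℕ.+_) (∣⊥∣≡0 n) ⟩
  ∣ r ∣ ℕ.+ 0              ≡⟨ ℕ.+-identityʳ _ ⟩
  ∣ r ∣                    ∎
  where
  open ℕ.≤-Reasoning
  ∪⊆r : p ∪ q ⊆ r
  ∪⊆r = [ p⊆r , q⊆r ]′ ∘ x∈p∪q⁻ p q
  ∩⊆⊥ : p ∩ q ⊆ ⊥
  ∩⊆⊥ x∈ = ⊥-elim (disjoint (proj₁ (x∈p∩q⁻ p q x∈)) (proj₂ (x∈p∩q⁻ p q x∈)))

minimal-subset : ∀ {n} {P : Subset n → Set} → Decidable P → (f : Subset n → ℕ) →
                 ∃ P → ∃ λ C → P C × (∀ {C′} → P C′ → f C ≤ f C′)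
minimal-subset {P = P} P? f (X , pX) = go (suc (f X)) X pX ≤-refl
  where
  go : ∀ k X → P X → f X < k → ∃ λ C → P C × (∀ {C′} → P C′ → f C ≤ f C′)
  go (suc k) X pX fX≤k with anySubset? (λ Y → P? Y ×-dec (f Y ℕ.<? f X))
  ... | yes (Y , pY , fY<fX) = go k Y pY (ℕ.<-≤-trans fY<fX (ℕ.≤-pred fX≤k))
  ... | no  none = X , pX , λ pY → ℕ.≮⇒≥ λ fY<fX → none (_ , pY , fY<fX)

-- Meant for `Small`, for which no decision procedure is given. There are only finitely many
-- subsets, so the double negation passes through the quantifier.
¬¬-decidable : ∀ {n} (P : Subset n → Set) → ¬ ¬ Decidable P
¬¬-decidable {zero}  P k = k λ where
  [] → no λ p → k λ where [] → yes p
¬¬-decidable {suc n} P k =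
  ¬¬-decidable (P ∘ (true ∷_)) λ P? →
  ¬¬-decidable (P ∘ (false ∷_)) λ Q? →
  k λ where
    (true  ∷ X) → P? X
    (false ∷ X) → Q? X

-- Vertex boundaries and sweeps.

module Closed (G : Graph) where
  open Graph G using (order; vertex; _~_)

  infix 4 _≃_
  _≃_ : Fin order → Fin order → Set
  i ≃ j = i ≡ j ⊎ vertex i ~ vertex j

module Sweep (H : Graph) (q : ℕ) where
  open Graph H using (order; vertex; _~_; _~?_)
  open Closed H

  exits? : ∀ X (i : Fin order) → Dec (i ∈ X × ∃ λ j → vertex i ~ vertex j × j ∉ X)
  exits? X i = (i ∈? X) ×-dec any? λ j → (vertex i ~? vertex j) ×-dec ¬? (j ∈? X)

  ∂ : Subset order → Subset order
  ∂ X = ⟨ exits? X ⟩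

  ∂⁺ : ∀ {X i j} → i ∈ X → vertex i ~ vertex j → j ∉ X → i ∈ ∂ X
  ∂⁺ {X} i∈X a j∉X = ⟨⟩⁺ (exits? X) (i∈X , _ , a , j∉X)

  ∂⁻ : ∀ {X i} → i ∈ ∂ X → i ∈ X × ∃ λ j → vertex i ~ vertex j × j ∉ X
  ∂⁻ {X} = ⟨⟩⁻ (exits? X)

  -- A vertex counted twice on the left lies in `X ∩ Y` and has a neighbour outside `X ∪ Y`, so it
  -- is counted twice on the right.
  ∂-submodular : ∀ X Y → ∣ ∂ (X ∩ Y) ∣ ℕ.+ ∣ ∂ (X ∪ Y) ∣ ≤ ∣ ∂ X ∣ ℕ.+ ∣ ∂ Y ∣
  ∂-submodular X Y = begin
    ∣ P ∣ ℕ.+ ∣ Q ∣                          ≡⟨ ∣p∪q∣+∣p∩q∣ P Q ⟨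
    ∣ P ∪ Q ∣ ℕ.+ ∣ P ∩ Q ∣                  ≤⟨ ℕ.+-mono-≤ (p⊆q⇒∣p∣≤∣q∣ union)
                                                           (p⊆q⇒∣p∣≤∣q∣ intersection) ⟩
    ∣ ∂ X ∪ ∂ Y ∣ ℕ.+ ∣ ∂ X ∩ ∂ Y ∣          ≡⟨ ∣p∪q∣+∣p∩q∣ (∂ X) (∂ Y) ⟩
    ∣ ∂ X ∣ ℕ.+ ∣ ∂ Y ∣                      ∎
    where
    open ℕ.≤-Reasoning
    P = ∂ (X ∩ Y)
    Q = ∂ (X ∪ Y)

    union : P ∪ Q ⊆ ∂ X ∪ ∂ Y
    union i∈ with x∈p∪q⁻ P Q i∈
    union i∈ | inj₁ i∈P with ∂⁻ i∈P
    ... | i∈X∩Y , j , a , j∉ with x∈p∩q⁻ X Y i∈X∩Y | j ∈? X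
    ...   | i∈X , i∈Y | no  j∉X = x∈p∪q⁺ (inj₁ (∂⁺ i∈X a j∉X))
    ...   | i∈X , i∈Y | yes j∈X = x∈p∪q⁺ (inj₂ (∂⁺ i∈Y a λ j∈Y → j∉ (x∈p∩q⁺ (j∈X , j∈Y))))
    union i∈ | inj₂ i∈Q with ∂⁻ i∈Q
    ... | i∈X∪Y , j , a , j∉ with x∈p∪q⁻ X Y i∈X∪Y
    ...   | inj₁ i∈X = x∈p∪q⁺ (inj₁ (∂⁺ i∈X a (j∉ ∘ x∈p∪q⁺ ∘ inj₁)))
    ...   | inj₂ i∈Y = x∈p∪q⁺ (inj₂ (∂⁺ i∈Y a (j∉ ∘ x∈p∪q⁺ ∘ inj₂)))

    intersection : P ∩ Q ⊆ ∂ X ∩ ∂ Y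
    intersection i∈ with x∈p∩q⁻ P Q i∈
    ... | i∈P , i∈Q with ∂⁻ i∈P | ∂⁻ i∈Q
    ...   | i∈X∩Y , _ | _ , j , a , j∉ with x∈p∩q⁻ X Y i∈X∩Y
    ...     | i∈X , i∈Y = x∈p∩q⁺ ( ∂⁺ i∈X a (j∉ ∘ x∈p∪q⁺ ∘ inj₁)
                                 , ∂⁺ i∈Y a (j∉ ∘ x∈p∪q⁺ ∘ inj₂))

  infixl 5 _∖_
  _∖_ : Subset order → Subset order → Subset order
  X ∖ Y = X ∩ ∁ Y

  ∖⁺ : ∀ {X Y i} → i ∈ X → i ∉ Y → i ∈ X ∖ Y
  ∖⁺ i∈X i∉Y = x∈p∩q⁺ (i∈X , x∉p⇒x∈∁p i∉Y)

  ∖⁻ : ∀ {X Y i} → i ∈ X ∖ Y → i ∈ X × i ∉ Y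
  ∖⁻ {X} {Y} i∈ = proj₁ (x∈p∩q⁻ X (∁ Y) i∈) , x∈∁p⇒x∉p (proj₂ (x∈p∩q⁻ X (∁ Y) i∈))

  -- Passing from X to Y uses the bag ∂ X ∪ (Y ∖ X).
  data Swept : Subset order → Set where
    empty  : Swept ⊥
    extend : ∀ {X Y} → Swept X → X ⊆ Y → ∣ ∂ X ∣ ℕ.+ ∣ Y ∖ X ∣ ≤ q → Swept Y

  -- Each stage of the sweep is intersected with `A`. Since `X ∪ A` lies between `A` and `Z`, its
  -- boundary is at least as large as `∂ A`; by submodularity `∂ (X ∩ A)` is then no larger than
  -- `∂ X`.
  truncate : ∀ {A Z} → A ⊆ Z → (∀ {C} → A ⊆ C → C ⊆ Z → ∣ ∂ A ∣ ≤ ∣ ∂ C ∣) →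
             ∀ {X} → Swept X → X ⊆ Z → Swept (X ∩ A)
  truncate {A} {Z} A⊆Z minimal empty _ =
    subst Swept (⊆-antisym (⊆-min _) (p∩q⊆p ⊥ A)) empty
  truncate {A} {Z} A⊆Z minimal (extend {X} {Y} s X⊆Y bound) Y⊆Z =
    extend (truncate A⊆Z minimal s X⊆Z) X∩A⊆Y∩A
      (≤-trans (ℕ.+-mono-≤ ∂-shrinks (p⊆q⇒∣p∣≤∣q∣ new-shrinks)) bound)
    where
    X⊆Z : X ⊆ Z
    X⊆Z = Y⊆Z ∘ X⊆Y
    X∩A⊆Y∩A : X ∩ A ⊆ Y ∩ A
    X∩A⊆Y∩A i∈ with x∈p∩q⁻ X A i∈
    ... | i∈X , i∈A = x∈p∩q⁺ (X⊆Y i∈X , i∈A)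
    X∪A⊆Z : X ∪ A ⊆ Z
    X∪A⊆Z = [ X⊆Z , A⊆Z ]′ ∘ x∈p∪q⁻ X A
    ∂-shrinks : ∣ ∂ (X ∩ A) ∣ ≤ ∣ ∂ X ∣
    ∂-shrinks = ℕ.+-cancelʳ-≤ (∣ ∂ (X ∪ A) ∣) _ _ (≤-trans (∂-submodular X A)
      (ℕ.+-monoʳ-≤ ∣ ∂ X ∣ (minimal (q⊆p∪q X A) X∪A⊆Z)))
    new-shrinks : (Y ∩ A) ∖ (X ∩ A) ⊆ Y ∖ X
    new-shrinks i∈ with ∖⁻ i∈
    ... | i∈Y∩A , i∉X∩A with x∈p∩q⁻ Y A i∈Y∩A
    ...   | i∈Y , i∈A = ∖⁺ i∈Y λ i∈X → i∉X∩A (x∈p∩q⁺ (i∈X , i∈A))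

  Small : Subset order → Set
  Small Y = ∃ λ Z → Swept Z × Y ⊆ Z

  small-⊆ : ∀ {X Y} → X ⊆ Y → Small Y → Small X
  small-⊆ X⊆Y (Z , s , Y⊆Z) = Z , s , Y⊆Z ∘ X⊆Y

  -- The witness is C ∪ Y, where C has the smallest boundary between Y ∩ Z and Z.
  enlarge : ∀ {Y Z} B → Swept Z → ∣ B ∣ ≤ q →
            (∀ {i j} → i ∈ Y → i ∉ B → i ≃ j → j ∈ Y ∩ Z) → Small Y
  enlarge {Y} {Z} B s ∣B∣≤q inner with minimal-subset
      (λ C → (Y ∩ Z ⊆? C) ×-dec (C ⊆? Z)) (λ C → ∣ ∂ C ∣)
      (Z , p∩q⊆q Y Z , λ i∈Z → i∈Z)
  ... | C , (Y∩Z⊆C , C⊆Z) , minimal =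
    C ∪ Y , extend sweptC (p⊆p∪q Y) bound , q⊆p∪q C Y
    where
    sweptC : Swept C
    sweptC = subst Swept (⊆-antisym (p∩q⊆q Z C) λ i∈C → x∈p∩q⁺ (C⊆Z i∈C , i∈C))
      (truncate C⊆Z (λ C⊆C′ C′⊆Z → minimal ((λ i∈ → C⊆C′ (Y∩Z⊆C i∈)) , C′⊆Z)) s (λ i∈Z → i∈Z))

    ∂⊆B : ∂ (Y ∩ Z) ⊆ B
    ∂⊆B {i} i∈ with i ∈? B | ∂⁻ i∈
    ... | yes i∈B | _ = i∈B
    ... | no  i∉B | i∈Y∩Z , j , a , j∉ =
      ⊥-elim (j∉ (inner (proj₁ (x∈p∩q⁻ Y Z i∈Y∩Z)) i∉B (inj₂ a)))

    split : ∀ {i} → i ∈ (C ∪ Y) ∖ C → i ∈ Y × i ∉ Y ∩ Z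
    split i∈ with ∖⁻ i∈
    ... | i∈C∪Y , i∉C with x∈p∪q⁻ C Y i∈C∪Y
    ...   | inj₁ i∈C = ⊥-elim (i∉C i∈C)
    ...   | inj₂ i∈Y = i∈Y , i∉C ∘ Y∩Z⊆C

    new⊆B : (C ∪ Y) ∖ C ⊆ B
    new⊆B {i} i∈ with i ∈? B
    ... | yes i∈B = i∈B
    ... | no  i∉B = ⊥-elim (proj₂ (split i∈) (inner (proj₁ (split i∈)) i∉B (inj₁ refl)))

    -- By minimality `∂ C` is no larger than `∂ (Y ∩ Z)`. The latter and the new vertices are
    -- disjoint parts of `B`, since new vertices avoid `Y ∩ Z`.
    bound : ∣ ∂ C ∣ ℕ.+ ∣ (C ∪ Y) ∖ C ∣ ≤ q
    bound = ≤-trans (ℕ.+-monoˡ-≤ _ (minimal ((λ i∈ → i∈) , p∩q⊆q Y Z)))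
      (≤-trans (∣p∣+∣q∣≤∣r∣ (λ i∈∂ i∈new → proj₂ (split i∈new) (proj₁ (∂⁻ i∈∂))) ∂⊆B new⊆B) ∣B∣≤q)

  -- From sweeps to path-decompositions.

  -- l gives the time at which each vertex of X is introduced; the rest wait until time m.
  record Timing (X : Subset order) : Set where
    field
      m       : ℕ
      l       : Fin order → ℕ
      early   : ∀ {i} → i ∈ X → l i < m
      waiting : ∀ {i} → i ∉ X → l i ≡ m
      bag     : ∀ {t} → t < m → ∃ λ S → ∣ S ∣ ≤ q ×
                  (∀ {i u} → l i ≤ t → i ≃ u → t ≤ l u → i ∈ S)

  -- Vertices outside `Y` are postponed by one; those of `Y ∖ X`, which waited until `m`, are now
  -- introduced at `m`. The premises in `bag` mirror `Alive`.
  timing : ∀ {X} → Swept X → Timing X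
  timing empty = record
    { m = 0 ; l = λ _ → 0 ; early = ⊥-elim ∘ ∉⊥ ; waiting = λ _ → refl ; bag = λ () }
  timing (extend {X} {Y} s X⊆Y bound) = record
    { m = suc m ; l = l′ ; early = early′ ; waiting = waiting′ ; bag = bag′ }
    where
    open Timing (timing s)
    l≤m : ∀ i → l i ≤ m
    l≤m i with i ∈? X
    ... | yes i∈X = ℕ.<⇒≤ (early i∈X)
    ... | no  i∉X = ≤-reflexive (waiting i∉X)

    l′ : Fin order → ℕ
    l′ i with i ∈? Y
    ... | yes _ = l i
    ... | no  _ = suc (l i)

    early′ : ∀ {i} → i ∈ Y → l′ i < suc m
    early′ {i} i∈Y with i ∈? Y
    ... | yes _   = s≤s (l≤m i)
    ... | no  i∉Y = ⊥-elim (i∉Y i∈Y)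

    waiting′ : ∀ {i} → i ∉ Y → l′ i ≡ suc m
    waiting′ {i} i∉Y with i ∈? Y
    ... | yes i∈Y = ⊥-elim (i∉Y i∈Y)
    ... | no  _   = cong suc (waiting (i∉Y ∘ X⊆Y))

    l≤l′ : ∀ i → l i ≤ l′ i
    l≤l′ i with i ∈? Y
    ... | yes _ = ≤-refl
    ... | no  _ = ℕ.n≤1+n _

    -- Only vertices already waiting until `m` are postponed, so comparisons with times up to `m` do
    -- not notice the change.
    lower : ∀ {t} i → t ≤ m → t ≤ l′ i → t ≤ l i
    lower i t≤m t≤l′ with i ∈? Y
    ... | yes _   = t≤l′
    ... | no  i∉Y = ≤-trans t≤m (≤-reflexive (sym (waiting (i∉Y ∘ X⊆Y))))

    late : ∀ {i} → m ≤ l′ i → i ∉ X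
    late m≤l′ i∈X = ℕ.<⇒≱ (early i∈X) (lower _ ≤-refl m≤l′)

    last : ∀ {i u} → l′ i ≤ m → i ≃ u → m ≤ l′ u → i ∈ ∂ X ∪ (Y ∖ X)
    last {i} l′≤m i≃u m≤l′ with i ∈? X | i ∈? Y | i≃u
    ... | yes i∈X | _       | inj₁ refl = ⊥-elim (late m≤l′ i∈X)
    ... | yes i∈X | _       | inj₂ a    = x∈p∪q⁺ (inj₁ (∂⁺ i∈X a (late m≤l′)))
    ... | no  i∉X | yes i∈Y | _         = x∈p∪q⁺ (inj₂ (∖⁺ i∈Y i∉X))
    ... | no  i∉X | no  i∉Y | _         =
      ⊥-elim (ℕ.<⇒≱ (≤-reflexive (cong suc (sym (waiting i∉X)))) l′≤m)

    bag′ : ∀ {t} → t < suc m → ∃ λ S → ∣ S ∣ ≤ q ×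
             (∀ {i u} → l′ i ≤ t → i ≃ u → t ≤ l′ u → i ∈ S)
    bag′ {t} (s≤s t≤m) with ℕ.m≤n⇒m<n∨m≡n t≤m
    ... | inj₂ refl = ∂ X ∪ (Y ∖ X) , ≤-trans (∣p∪q∣≤∣p∣+∣q∣ (∂ X) (Y ∖ X)) bound , last
    ... | inj₁ t<m with bag t<m
    ...   | S , ∣S∣≤q , in-bag = S , ∣S∣≤q , λ {i} {u} l≤t i≃u t≤l →
            in-bag (≤-trans (l≤l′ i) l≤t) i≃u (lower u t≤m t≤l)

  swept⊤⇒decomposition : Swept ⊤ → ∃ λ (D : PathDecomposition H) → maxBag D ≤ q
  swept⊤⇒decomposition s = layout H l₀ , max≤v⁺ z≤n (All.tabulate⁺ bags)
    where
    open Timing (timing s)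
    l₀ : Fin order → Fin (suc m)
    l₀ i = fromℕ< (ℕ.m<n⇒m<1+n (early (∈⊤ {x = i})))
    l₀≡ : ∀ i → toℕ (l₀ i) ≡ l i
    l₀≡ i = toℕ-fromℕ< _
    bags : ∀ t → ∣ ⟨ alive? H l₀ t ⟩ ∣ ≤ q
    bags t with toℕ t ℕ.<? m
    ... | yes t<m with bag t<m
    ...   | S , ∣S∣≤q , in-bag = ≤-trans (p⊆q⇒∣p∣≤∣q∣ sub) ∣S∣≤q
      where
      sub : ⟨ alive? H l₀ t ⟩ ⊆ S
      sub {i} i∈ with ⟨⟩⁻ (alive? H l₀ t) i∈
      ... | l≤t , u , i≃u , t≤l =
        in-bag (subst (_≤ toℕ t) (l₀≡ i) l≤t) i≃u (subst (toℕ t ≤_) (l₀≡ u) t≤l)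
    -- `layout` also has a bag at time `m`. After a sweep of `⊤` no vertex is introduced that late,
    -- so this bag is empty.
    bags t | no t≮m = ≤-trans (p⊆q⇒∣p∣≤∣q∣ sub) (≤-trans (≤-reflexive (∣⊥∣≡0 order)) z≤n)
      where
      sub : ⟨ alive? H l₀ t ⟩ ⊆ ⊥
      sub {i} i∈ with ⟨⟩⁻ (alive? H l₀ t) i∈
      ... | _ , u , _ , t≤l =
        ⊥-elim (t≮m (ℕ.≤-<-trans (subst (toℕ t ≤_) (l₀≡ u) t≤l) (early ∈⊤)))

-- Counting a subset of a product by rows.

∣p++q∣ : ∀ {m n} (p : Subset m) (q : Subset n) → ∣ p ++ q ∣ ≡ ∣ p ∣ ℕ.+ ∣ q ∣
∣p++q∣ []          q = refl
∣p++q∣ (true  ∷ p) q = cong suc (∣p++q∣ p q)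
∣p++q∣ (false ∷ p) q = ∣p++q∣ p q

row? : ∀ {m n} (S : Subset (m ℕ.* n)) (i : Fin m) → Decidable (λ (j : Fin n) → combine i j ∈ S)
row? S i j = combine i j ∈? S

-- `combine` lists the product row by row, so splitting off the first `n` entries of `S` removes row
-- `zero`.
∣p∣*k≤∣S∣ : ∀ {m n} k (p : Subset m) (S : Subset (m ℕ.* n)) →
            (∀ {i} → i ∈ p → k ≤ ∣ ⟨ row? S i ⟩ ∣) → ∣ p ∣ ℕ.* k ≤ ∣ S ∣
∣p∣*k≤∣S∣             k []      S rows = z≤n
∣p∣*k≤∣S∣ {suc m} {n} k (b ∷ p) S rows with splitAt n S
... | xs , ys , refl = subst (∣ b ∷ p ∣ ℕ.* k ≤_) (sym (∣p++q∣ xs ys)) (bound b rows)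
  where
  head-row : ⟨ row? {suc m} (xs ++ ys) zero ⟩ ⊆ xs
  head-row {j} j∈ = lookup⇒[]= j xs (trans (sym (lookup-++ˡ xs ys j))
    ([]=⇒lookup (⟨⟩⁻ (row? {suc m} (xs ++ ys) zero) j∈)))

  tail-row : ∀ i → ⟨ row? {suc m} (xs ++ ys) (suc i) ⟩ ⊆ ⟨ row? ys i ⟩
  tail-row i {j} j∈ = ⟨⟩⁺ (row? ys i) (lookup⇒[]= (combine i j) ys
    (trans (sym (lookup-++ʳ xs ys (combine i j)))
      ([]=⇒lookup (⟨⟩⁻ (row? {suc m} (xs ++ ys) (suc i)) j∈))))

  bound : ∀ b → (∀ {i} → i ∈ b ∷ p → k ≤ ∣ ⟨ row? {suc m} (xs ++ ys) i ⟩ ∣) →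
          ∣ b ∷ p ∣ ℕ.* k ≤ ∣ xs ∣ ℕ.+ ∣ ys ∣
  bound b rows with ∣p∣*k≤∣S∣ k p ys (λ {i} i∈p →
                      ≤-trans (rows (there i∈p)) (p⊆q⇒∣p∣≤∣q∣ (tail-row i)))
  bound true  rows | ih = ℕ.+-mono-≤ (≤-trans (rows here) (p⊆q⇒∣p∣≤∣q∣ head-row)) ih
  bound false rows | ih = ≤-trans ih (ℕ.m≤n+m _ _)

maxBag-bound : ∀ {G} (D : PathDecomposition G) {k N} →
               (∀ t → ∣ PathDecomposition.β D t ∣ ℕ.* k ≤ N) → maxBag D ℕ.* k ≤ N
maxBag-bound D {k} {N} bound = argmax-all id {P = λ b → b ℕ.* k ≤ N} z≤n
  (All.tabulate⁺ {f = λ t → ∣ PathDecomposition.β D t ∣} bound)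

∣β∣≤maxBag : ∀ {G} (D : PathDecomposition G) t → ∣ PathDecomposition.β D t ∣ ≤ maxBag D
∣β∣≤maxBag D = All.tabulate⁻ (xs≤max 0 (tabulate λ t → ∣ PathDecomposition.β D t ∣))

-- Projecting a path-decomposition of the product to `G`.

module Project (G H : Graph) (q : ℕ) (D : PathDecomposition (G ⊠ H))
               (wide : ∀ (E : PathDecomposition H) → q < maxBag E)
               (small? : Decidable (Sweep.Small H q)) where
  private
    module G = Graph G
    module H = Graph H
    module CG = Closed G
    module CH = Closed H
  open PathDecomposition D using (ℓ; β; nonempty; edges)
  open Sweep H q using (Swept; empty; Small; small-⊆; enlarge; swept⊤⇒decomposition)

  -- The strong product enters here: pairs equal or adjacent in each coordinate are equal or
  -- adjacent in `G ⊠ H`, diagonals included.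
  common-bag : ∀ {i i′ j j′} → i CG.≃ i′ → j CH.≃ j′ →
               ∃ λ t → combine i j ∈ β t × combine i′ j′ ∈ β t
  common-bag {i} {i′} {j} {j′} i≃i′ j≃j′ =
    subst₂ (λ x y → ∃ λ t → x ∈ β t × y ∈ β t) (at≡ i j) (at≡ i′ j′) (vertices i≃i′ j≃j′)
    where
    at : Fin G.order → Fin H.order → Fin (G.order ℕ.* H.order)
    at i j = combine (G.index (G.vertex i)) (H.index (H.vertex j))
    at≡ : ∀ i j → at i j ≡ combine i j
    at≡ i j = cong₂ combine (index∘vertex G i) (index∘vertex H j)
    vertices : i CG.≃ i′ → j CH.≃ j′ → ∃ λ t → at i j ∈ β t × at i′ j′ ∈ β t
    vertices (inj₁ refl) (inj₁ refl) =
      let t , ∈t = nonempty (G.vertex i , H.vertex j) in t , ∈t , ∈t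
    vertices (inj₁ refl) (inj₂ b)    = edges (inj₁ (refl , b))
    vertices (inj₂ a)    (inj₁ refl) = edges (inj₂ (inj₁ (a , refl)))
    vertices (inj₂ a)    (inj₂ b)    = edges (inj₂ (inj₂ (a , b)))

  in-bag? : ∀ t (i : Fin G.order) → Decidable (λ (j : Fin H.order) → combine i j ∈ β t)
  in-bag? t = row? {G.order} {H.order} (β t)

  bag : Fin (suc ℓ) → Fin G.order → Subset H.order
  bag t i = ⟨ in-bag? t i ⟩

  -- The bag at `t` itself is excluded. Times are naturals, so that `suc ℓ` is available for the
  -- whole fibre.
  seen? : ∀ t (i : Fin G.order) → Decidable (λ (j : Fin H.order) → ∃ λ s → toℕ s < t × combine i j ∈ β s)
  seen? t i j = any? λ s → (toℕ s ℕ.<? t) ×-dec in-bag? s i j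

  seen : ℕ → Fin G.order → Subset H.order
  seen t i = ⟨ seen? t i ⟩

  seen-mono : ∀ {s t} i → s ≤ t → seen s i ⊆ seen t i
  seen-mono {s} {t} i s≤t j∈ with ⟨⟩⁻ (seen? s i) j∈
  ... | r , r<s , j∈r = ⟨⟩⁺ (seen? t i) (r , ℕ.<-≤-trans r<s s≤t , j∈r)

  -- A vertex that has left the fibre over i by time t has met all its neighbours,
  -- also those in an adjacent fibre.
  departed : ∀ {t i i′ j j′} → i CG.≃ i′ → j CH.≃ j′ →
             j ∈ seen (suc (toℕ t)) i → j ∉ bag t i → j′ ∈ seen (toℕ t) i′
  departed {t} {i} {i′} {j} i≃i′ j≃j′ j∈seen j∉bag
    with ⟨⟩⁻ (seen? (suc (toℕ t)) i) j∈seen | common-bag i≃i′ j≃j′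
  ... | s , s<1+t , j∈s | r , j∈r , j′∈r with toℕ r ℕ.<? toℕ t
  ...   | yes r<t = ⟨⟩⁺ (seen? (toℕ t) i′) (r , r<t , j′∈r)
  ...   | no  r≮t = ⊥-elim (j∉bag (⟨⟩⁺ (in-bag? t i)
    (convex (G ⊠ H) D (combine i j) {s} {t} {r} j∈s j∈r (ℕ.≤-pred s<1+t) (ℕ.≮⇒≥ r≮t))))

  -- `departed` is applied twice to a vertex that has left the fibre over `i`: its closed neighbours
  -- have been seen over `i`, and also over `i′`, hence lie in `Z`. This is what `enlarge` asks for.
  step : ∀ {t i i′} → i CG.≃ i′ → ∣ bag t i ∣ ≤ q →
         Small (seen (toℕ t) i′) → Small (seen (suc (toℕ t)) i)
  step {t} {i} i≃i′ narrow (Z , swept , seen⊆Z) = enlarge (bag t i) swept narrow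
    λ j∈ j∉ j≃j′ → x∈p∩q⁺
      ( seen-mono i (ℕ.n≤1+n _) (departed (inj₁ refl) j≃j′ j∈ j∉)
      , seen⊆Z (departed i≃i′ j≃j′ j∈ j∉))

  Passed : Fin G.order → Fin (suc ℓ) → Set
  Passed i t = ¬ Small (seen (suc (toℕ t)) i)

  passed? : ∀ i → Decidable (Passed i)
  passed? i t = ¬? (small? (seen (suc (toℕ t)) i))

  passed-mono : ∀ {i s t} → s Fin.≤ t → Passed i s → Passed i t
  passed-mono {i} s≤t passed = passed ∘ small-⊆ (seen-mono i (s≤s s≤t))

  -- By the end the whole fibre has been seen; were it small, `⊤` would be swept, contradicting
  -- `wide`.
  passed-last : ∀ i → Passed i (fromℕ ℓ)
  passed-last i (Z , swept , seen⊆Z) = ℕ.<⇒≱ (wide (proj₁ narrow)) (proj₂ narrow)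
    where
    all-seen : ∀ j → j ∈ seen (suc (toℕ (fromℕ ℓ))) i
    all-seen j =
      let s , j∈s , _ = common-bag {i} {i} {j} {j} (inj₁ refl) (inj₁ refl) in
      ⟨⟩⁺ (seen? _ i) (s , ≤-trans (toℕ<n s) (≤-reflexive (cong suc (sym (toℕ-fromℕ ℓ)))) , j∈s)

    narrow : ∃ λ (E : PathDecomposition H) → maxBag E ≤ q
    narrow = swept⊤⇒decomposition
      (subst Swept (⊆-antisym (⊆-max Z) λ {j} _ → seen⊆Z (all-seen j)) swept)

  first-passed : ∀ i → ∃ λ t → Passed i t × (∀ {s} → Passed i s → t Fin.≤ s)
  first-passed i = least (passed? i) (fromℕ ℓ , passed-last i)

  τ : Fin G.order → Fin (suc ℓ)
  τ i = proj₁ (first-passed i)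

  -- `seen (toℕ s)` omits the bag at `s`, so it is what `Passed` tests one time earlier. This is why
  -- `s` may equal `τ i`.
  small-until-τ : ∀ i (s : Fin (suc ℓ)) → s Fin.≤ τ i → Small (seen (toℕ s) i)
  small-until-τ i zero    _   = ⊥ , empty , none
    where
    none : seen 0 i ⊆ ⊥
    none j∈ with ⟨⟩⁻ (seen? 0 i) j∈
    ... | _ , () , _
  small-until-τ i (suc s) s<τ = subst (λ k → Small (seen (suc k) i)) (toℕ-inject₁ s)
    (decidable-stable (small? _) λ passed → ℕ.<⇒≱ s<τ
      (≤-trans (proj₂ (proj₂ (first-passed i)) {inject₁ s} passed)
               (≤-reflexive (toℕ-inject₁ s))))

  -- The condition covers all passed times up to `t`: a vertex that drops out never returns, which
  -- makes the active times an interval.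
  Active : Fin (suc ℓ) → Fin G.order → Set
  Active t i = Passed i t × (∀ s → s Fin.≤ t × Passed i s → q < ∣ bag s i ∣)

  active? : ∀ t → Decidable (Active t)
  active? t i = passed? i t ×-dec
    all? λ s → ((s Fin.≤? t) ×-dec passed? i s) →-dec (q ℕ.<? ∣ bag s i ∣)

  active-convex : ∀ i → Convex (λ t → Active t i)
  active-convex i {s} {m} {t} (passed , _) (_ , big) s≤m m≤t =
    passed-mono {i} {s} {m} s≤m passed , λ r (r≤m , passed-r) → big r (≤-trans r≤m m≤t , passed-r)

  -- A narrow bag over `i` at a passed time `s` up to `τ i′` would let `step` carry smallness over
  -- `i′` before `s` to `i` after `s`. Equal `i` and `i′` give activity at `τ i`.
  active-τ : ∀ {i i′} → i CG.≃ i′ → τ i Fin.≤ τ i′ → Active (τ i′) i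
  active-τ {i} {i′} i≃i′ τ≤τ′ =
    passed-mono {i} {τ i} {τ i′} τ≤τ′ (proj₁ (proj₂ (first-passed i))) ,
    λ s (s≤τ′ , passed) → ℕ.≰⇒> λ narrow →
      passed (step {s} i≃i′ narrow (small-until-τ i′ s s≤τ′))

  projection : PathDecomposition G
  projection = record
    { ℓ         = ℓ
    ; β         = λ t → ⟨ active? t ⟩
    ; nonempty  = λ v → τ (G.index v) , ⟨⟩⁺ (active? _) (active-τ (inj₁ refl) ≤-refl)
    ; connected = λ v → convex⇒connected λ {s} {m} {t} p r s≤m m≤t → ⟨⟩⁺ (active? m)
        (active-convex (G.index v) {s} {m} {t}
          (⟨⟩⁻ (active? s) p) (⟨⟩⁻ (active? t) r) s≤m m≤t)
    ; edges     = λ {u} {v} u~v → shared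
        (subst₂ G._~_ (sym (vertex∘index G u)) (sym (vertex∘index G v)) u~v)
    }
    where
    shared : ∀ {i i′} → G.vertex i G.~ G.vertex i′ →
             ∃ λ t → i ∈ ⟨ active? t ⟩ × i′ ∈ ⟨ active? t ⟩
    shared {i} {i′} a with ℕ.≤-total (toℕ (τ i)) (toℕ (τ i′))
    ... | inj₁ τ≤τ′ = τ i′ , ⟨⟩⁺ (active? _) (active-τ (inj₂ a) τ≤τ′)
                           , ⟨⟩⁺ (active? _) (active-τ (inj₁ refl) ≤-refl)
    ... | inj₂ τ′≤τ = τ i , ⟨⟩⁺ (active? _) (active-τ (inj₁ refl) ≤-refl)
                          , ⟨⟩⁺ (active? _) (active-τ (inj₂ (G.~-sym a)) τ′≤τ)

  projection-≤ : maxBag projection ℕ.* suc q ≤ maxBag D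
  projection-≤ = maxBag-bound projection λ t → ≤-trans
    (∣p∣*k≤∣S∣ (suc q) ⟨ active? t ⟩ (β t) λ {i} i∈ → active⇒wide (⟨⟩⁻ (active? t) i∈))
    (∣β∣≤maxBag D t)
    where
    active⇒wide : ∀ {t i} → Active t i → q < ∣ bag t i ∣
    active⇒wide {t} (passed , big) = big t (≤-refl , passed)

-- From bag sizes to pathwidth.

maxBag-⊠ : ∀ G H {k l} → (∀ (E : PathDecomposition G) → k ≤ maxBag E) →
           (∀ (E : PathDecomposition H) → l ≤ maxBag E) →
           ∀ (D : PathDecomposition (G ⊠ H)) → k ℕ.* l ≤ maxBag D
maxBag-⊠ G H {k} {zero}  _     _     D = ≤-trans (≤-reflexive (ℕ.*-zeroʳ k)) z≤n
-- The goal is decidable, hence stable under double negation, so `Small` may be assumed decidable.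
maxBag-⊠ G H {k} {suc q} wideG wideH D = decidable-stable (_ ℕ.≤? _) λ fails →
  ¬¬-decidable (Sweep.Small H q) λ small? → fails
    (≤-trans (ℕ.*-monoˡ-≤ (suc q) (wideG (Project.projection G H q D wideH small?)))
             (Project.projection-≤ G H q D wideH small?))

i-1+1 : ∀ i → i - + 1 + + 1 ≡ i
i-1+1 i = trans (ℤ.+-assoc i _ _) (ℤ.+-identityʳ i)

-- Passing to bag sizes turns the claim into a product inequality of naturals, even where the
-- pathwidth is -1.
minimum-bag : ∀ G {p} → IsPathwidth G p →
              ∃ λ k → p + + 1 ≡ + k × (∀ (E : PathDecomposition G) → k ≤ maxBag E)
minimum-bag G {p} ((D , width≡) , minimal) = maxBag D , p+1≡ , λ E →
  ℤ.drop‿+≤+ (subst₂ ℤ._≤_ p+1≡ (i-1+1 (+ maxBag E)) (ℤ.+-monoˡ-≤ (+ 1) (minimal E)))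
  where
  p+1≡ : p + + 1 ≡ + maxBag D
  p+1≡ = trans (cong (_+ + 1) (sym width≡)) (i-1+1 (+ maxBag D))

theorem2 : (G H : Graph) →
    pw (G ⊠ H) ≥ (pw G + + 1) * (pw H + + 1) - + 1
theorem2 G H =
  let k , p≡ , wideG = minimum-bag G (pw-isPathwidth G)
      l , r≡ , wideH = minimum-bag H (pw-isPathwidth H)
      (D , width≡) , _ = pw-isPathwidth (G ⊠ H)
  in subst₂ ℤ._≤_ (cong (_- + 1) (trans (ℤ.pos-* k l) (sym (cong₂ _*_ p≡ r≡)))) width≡
       (ℤ.+-monoˡ-≤ (- + 1) (ℤ.+≤+ (maxBag-⊠ G H wideG wideH D)))
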